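{- Let $G$ be a graph on $n$ vertices with minimum degree $\delta(G) \geq 7n/8$, whose edges are coloured with three colours. Then the vertex set of $G$ can be covered by monochromatic components of distinct colours, i.e. there are monochromatic components, no two of the same colour (so at most three of them), whose union is $V(G)$.
   Context: The three colours are red, blue and yellow. For a colour $c$, a component of colour $c$ is the vertex set of a connected component of the spanning subgraph of $G$ with vertex set $V(G)$ and edge set the edges of colour $c$ (so a vertex incident with no edge of colour $c$ forms a component of colour $c$ by itself). A monochromatic component is a component of some colour. -}

module Defs where

open import Data.Nat using (ℕ; zero; suc; _+_; _*_; _≤_)
open import Data.Fin using (Fin)
open import Data.Bool using (Bool; true; false)
open import Data.List using (List; filter; length)
open import Data.List using () renaming (allFin to allFinL)
open import Data.Maybe using (Maybe; just; nothing)
open import Data.Product using (Σ; ∃; _×_; _,_)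
open import Relation.Binary.PropositionalEquality using (_≡_)
open import Relation.Nullary using (¬_)
open import Data.Bool using (T; T?)
open import Data.Empty using (⊥)

data Colour : Set where
  red blue yellow : Colour

record Graph (n : ℕ) : Set where
  field
    adj     : Fin n → Fin n → Bool
    symm    : ∀ u v → adj u v ≡ adj v u
    irrefl  : ∀ v → adj v v ≡ false

open Graph public

degree : ∀ {n} → Graph n → Fin n → ℕ
degree G v = length (filter (λ u → T? (adj G v u)) (allFinL _))

-- An edge-colouring with three colours: a symmetric assignment of colours
-- to pairs (only its values on edges matter).
record EdgeColouring {n : ℕ} (G : Graph n) : Set where
  field
    colour   : Fin n → Fin n → Colour
    colSymm  : ∀ u v → T (adj G u v) → colour u v ≡ colour v u

open EdgeColouring public

ColEdge : ∀ {n} {G : Graph n} → EdgeColouring G → Colour → Fin n → Fin n → Set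
ColEdge {G = G} χ c u v = T (adj G u v) × colour χ u v ≡ c

-- Reachability in the spanning subgraph of colour-c edges.
-- The component of colour c containing r is { v | Reach χ c r v }.
data Reach {n} {G : Graph n} (χ : EdgeColouring G) (c : Colour) (r : Fin n) : Fin n → Set where
  here : Reach χ c r r
  step : ∀ {u v} → Reach χ c r u → ColEdge χ c u v → Reach χ c r v

InComp : ∀ {n} {G : Graph n} → EdgeColouring G → Colour → Maybe (Fin n) → Fin n → Set
InComp χ c nothing  v = ⊥
InComp χ c (just r) v = Reach χ c r v

-- A choice of at most one monochromatic component of each colour
-- (given by a representative vertex, or none) covering all vertices.
CoveredByDistinctColourComponents : ∀ {n} {G : Graph n} → EdgeColouring G → Set
CoveredByDistinctColourComponents {n} χ =
  Σ (Colour → Maybe (Fin n)) λ root →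
    ∀ v → Σ Colour λ c → InComp χ c (root c) v

{-# OPTIONS --safe #-}
-- Label the components of each colour by integers, and let r v, b v, y v be the
-- labels of the components containing v.  The vertices v and x lie in a common
-- component iff the polynomial (X - r v)(Y - b v)(Z - y v) vanishes at the point
-- (r x, b x, y x).  These polynomials live in a space of dimension 8,
-- so at most 8 of them span all of them: if x shares a component with each of some
-- 8 fixed vertices, then it shares one with every vertex.  A vertex has at most
-- n/8 - 1 non-neighbours other than itself, so some x is equal or adjacent to each
-- of these 8 vertices, and the three components containing x cover the graph.
module Submission where

open import Defs
open import Data.Nat using (ℕ; _*_; _≤_)
open import Data.Fin using (Fin)
open import Data.Fin using (toℕ)
open import Data.Fin.Properties using (_≟_; any?; toℕ-injective)
open import Data.Bool using (T; T?)
open import Data.Integer using (ℤ; +_; 0ℤ; 1ℤ)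
open import Data.Integer.Tactic.RingSolver using (solve-∀)
open import Data.List using (List; []; _∷_; length; filter; allFin; cartesianProduct)
open import Data.List.Membership.Propositional using (_∈_)
open import Data.List.Membership.Propositional.Properties using (∈-allFin; ∈-cartesianProduct⁺; ∈-filter⁺; ∈-filter⁻)
open import Data.List.Properties using (length-tabulate)
open import Data.List.Relation.Binary.Sublist.Propositional using (⊆-refl)
open import Data.List.Relation.Binary.Sublist.Propositional.Properties using (filter-⊆; filter⁺; length-mono-≤)
open import Data.List.Relation.Unary.All as All using (All; []; _∷_)
open import Data.List.Relation.Unary.All.Properties using (all-filter)
import Data.List.Relation.Unary.Any as Any
open import Data.Maybe using (just; nothing)
open import Data.Product using (∃; _×_; _,_; proj₁; proj₂; uncurry)
open import Data.Sum using (_⊎_; inj₁; inj₂; [_,_]′)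
open import Data.Vec using (Vec; []; _∷_; head; tail; zipWith)
open import Function using (_∘_; id)
open import Relation.Binary using (Rel; IsEquivalence)
open import Relation.Binary.PropositionalEquality using (_≡_; refl; sym; trans; cong; cong₂; subst; module ≡-Reasoning)
open import Relation.Nullary using (¬_; Dec; yes; no; contradiction; ¬?)
open import Relation.Nullary.Decidable using (decidable-stable; _×-dec_; _⊎-dec_)
open import Relation.Unary using (Pred; Decidable)
import Data.Integer as ℤ
import Data.Integer.Properties as ℤ
import Data.Nat as ℕ
import Data.Nat.Properties as ℕ
import Data.Nat.Tactic.RingSolver as ℕ-Ring

-- Linear algebra over the integers: spanning by few vectors.

infix 7 _·_

-- The left vector acts as a functional. Spanning is expressed dually, through the functionals that
-- vanish, so everything stays in ℤ.
_·_ : ∀ {d} → Vec ℤ d → Vec ℤ d → ℤ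
[]      · []      = 0ℤ
(x ∷ φ) · (a ∷ v) = x ℤ.* a ℤ.+ φ · v

·-linearʳ : ∀ {d} p q (φ v w : Vec ℤ d) →
            φ · zipWith (λ a b → p ℤ.* a ℤ.- q ℤ.* b) v w ≡ p ℤ.* (φ · v) ℤ.- q ℤ.* (φ · w)
·-linearʳ p q []      []      []      = zero-combination p q
  where
  zero-combination : ∀ p q → 0ℤ ≡ p ℤ.* 0ℤ ℤ.- q ℤ.* 0ℤ
  zero-combination = solve-∀
·-linearʳ p q (x ∷ φ) (a ∷ v) (b ∷ w) =
  trans (cong (λ k → x ℤ.* (p ℤ.* a ℤ.- q ℤ.* b) ℤ.+ k) (·-linearʳ p q φ v w))
        (regroup p q x a b (φ · v) (φ · w))
  where
  regroup : ∀ p q x a b s t →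
            x ℤ.* (p ℤ.* a ℤ.- q ℤ.* b) ℤ.+ (p ℤ.* s ℤ.- q ℤ.* t) ≡
            p ℤ.* (x ℤ.* a ℤ.+ s) ℤ.- q ℤ.* (x ℤ.* b ℤ.+ t)
  regroup = solve-∀

·-head-tail : ∀ {d} x (φ : Vec ℤ d) v → (x ∷ φ) · v ≡ x ℤ.* head v ℤ.+ φ · tail v
·-head-tail x φ (a ∷ v) = refl

-- Division-free Gaussian elimination on the first coordinate.
spanning-sublist : ∀ {n} d (f : Fin n → Vec ℤ d) →
  ∃ λ (bs : List (Fin n)) → length bs ≤ d ×
    (∀ φ → All (λ b → φ · f b ≡ 0ℤ) bs → ∀ i → φ · f i ≡ 0ℤ)
spanning-sublist ℕ.zero f = [] , ℕ.z≤n , λ φ _ i → vanish φ (f i)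
  where
  vanish : ∀ (φ v : Vec ℤ 0) → φ · v ≡ 0ℤ
  vanish [] [] = refl
spanning-sublist (ℕ.suc d) f with any? (λ i → ¬? (head (f i) ℤ.≟ 0ℤ))
... | no noPivot = bs , ℕ.m≤n⇒m≤1+n |bs|≤d , spans
  where
  rec    = spanning-sublist d (tail ∘ f)
  bs     = proj₁ rec
  |bs|≤d = proj₁ (proj₂ rec)

  dropHead : ∀ x φ i → (x ∷ φ) · f i ≡ φ · tail (f i)
  dropHead x φ i = begin
    (x ∷ φ) · f i                         ≡⟨ ·-head-tail x φ (f i) ⟩
    x ℤ.* head (f i) ℤ.+ φ · tail (f i)   ≡⟨ cong (λ h → x ℤ.* h ℤ.+ φ · tail (f i)) head≡0 ⟩
    x ℤ.* 0ℤ ℤ.+ φ · tail (f i)           ≡⟨ cong (ℤ._+ φ · tail (f i)) (ℤ.*-zeroʳ x) ⟩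
    0ℤ ℤ.+ φ · tail (f i)                 ≡⟨ ℤ.+-identityˡ _ ⟩
    φ · tail (f i)                        ∎
    where
    open ≡-Reasoning
    head≡0 = decidable-stable (head (f i) ℤ.≟ 0ℤ) λ h≢0 → noPivot (i , h≢0)

  spans : ∀ φ → All (λ b → φ · f b ≡ 0ℤ) bs → ∀ i → φ · f i ≡ 0ℤ
  spans (x ∷ φ) zeros i = trans (dropHead x φ i)
    (proj₂ (proj₂ rec) φ (All.map (λ {b} → trans (sym (dropHead x φ b))) zeros) i)
... | yes (p , pivot≢0) = p ∷ bs , ℕ.s≤s (proj₁ (proj₂ rec)) , spans
  where
  pivot = head (f p)

  -- This is `pivot` times `f i` minus `head (f i)` times `f p`, cross-multiplied to avoid division;
  -- its first coordinate cancels and is dropped.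
  reduced : Fin _ → Vec ℤ d
  reduced i = zipWith (λ a b → pivot ℤ.* a ℤ.- head (f i) ℤ.* b) (tail (f i)) (tail (f p))

  rec = spanning-sublist d reduced
  bs  = proj₁ rec

  eliminate : ∀ x φ i → pivot ℤ.* ((x ∷ φ) · f i) ≡ φ · reduced i ℤ.+ head (f i) ℤ.* ((x ∷ φ) · f p)
  eliminate x φ i = begin
    pivot ℤ.* ((x ∷ φ) · f i)
      ≡⟨ cong (pivot ℤ.*_) (·-head-tail x φ (f i)) ⟩
    pivot ℤ.* (x ℤ.* h ℤ.+ s)
      ≡⟨ regroup pivot h x s t ⟩
    (pivot ℤ.* s ℤ.- h ℤ.* t) ℤ.+ h ℤ.* (x ℤ.* pivot ℤ.+ t)
      ≡⟨ cong₂ (λ k l → k ℤ.+ h ℤ.* l) (·-linearʳ pivot h φ (tail (f i)) (tail (f p))) (·-head-tail x φ (f p)) ⟨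
    φ · reduced i ℤ.+ h ℤ.* ((x ∷ φ) · f p) ∎
    where
    open ≡-Reasoning
    h = head (f i)
    s = φ · tail (f i)
    t = φ · tail (f p)
    regroup : ∀ q h x s t → q ℤ.* (x ℤ.* h ℤ.+ s) ≡ (q ℤ.* s ℤ.- h ℤ.* t) ℤ.+ h ℤ.* (x ℤ.* q ℤ.+ t)
    regroup = solve-∀

  spans : ∀ φ → All (λ b → φ · f b ≡ 0ℤ) (p ∷ bs) → ∀ i → φ · f i ≡ 0ℤ
  spans (x ∷ φ) (zero-p ∷ zeros) i =
    -- ℤ has no zero divisors, so the nonzero factor `pivot` can be cancelled.
    [ (λ pivot≡0 → contradiction pivot≡0 pivot≢0) , id ]′ (ℤ.i*j≡0⇒i≡0∨j≡0 pivot scaled≡0)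
    where
    eliminate′ : ∀ j → pivot ℤ.* ((x ∷ φ) · f j) ≡ φ · reduced j
    eliminate′ j = begin
      pivot ℤ.* ((x ∷ φ) · f j)                                ≡⟨ eliminate x φ j ⟩
      φ · reduced j ℤ.+ head (f j) ℤ.* ((x ∷ φ) · f p)         ≡⟨ cong (λ k → φ · reduced j ℤ.+ head (f j) ℤ.* k) zero-p ⟩
      φ · reduced j ℤ.+ head (f j) ℤ.* 0ℤ                      ≡⟨ cong (λ k → φ · reduced j ℤ.+ k) (ℤ.*-zeroʳ (head (f j))) ⟩
      φ · reduced j ℤ.+ 0ℤ                                     ≡⟨ ℤ.+-identityʳ _ ⟩
      φ · reduced j                                            ∎
      where open ≡-Reasoning

    scaled≡0 : pivot ℤ.* ((x ∷ φ) · f i) ≡ 0ℤ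
    scaled≡0 = trans (eliminate′ i) (proj₂ (proj₂ rec) φ (All.map reduced≡0 zeros) i)
      where
      reduced≡0 : ∀ {b} → (x ∷ φ) · f b ≡ 0ℤ → φ · reduced b ≡ 0ℤ
      reduced≡0 {b} zero-b = trans (sym (eliminate′ b)) (trans (cong (pivot ℤ.*_) zero-b) (ℤ.*-zeroʳ pivot))

-- The polynomials (X - a)(Y - b)(Z - c) as coefficient vectors.

monomials coefficients : ℤ → ℤ → ℤ → Vec ℤ 8
monomials x y z =
  x ℤ.* y ℤ.* z ∷ y ℤ.* z ∷ x ℤ.* z ∷ x ℤ.* y ∷ z ∷ y ∷ x ∷ 1ℤ ∷ []
coefficients a b c =
  1ℤ ∷ ℤ.- a ∷ ℤ.- b ∷ ℤ.- c ∷ a ℤ.* b ∷ a ℤ.* c ∷ b ℤ.* c ∷ ℤ.- (a ℤ.* b ℤ.* c) ∷ []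

monomials·coefficients : ∀ x y z a b c →
  monomials x y z · coefficients a b c ≡ (x ℤ.- a) ℤ.* ((y ℤ.- b) ℤ.* (z ℤ.- c))
monomials·coefficients = expand
  where
  -- The pairing unfolded by computation into a ring identity that the solver can read.
  expand : ∀ x y z a b c →
    x ℤ.* y ℤ.* z ℤ.* 1ℤ ℤ.+ (y ℤ.* z ℤ.* (ℤ.- a) ℤ.+ (x ℤ.* z ℤ.* (ℤ.- b) ℤ.+ (x ℤ.* y ℤ.* (ℤ.- c) ℤ.+
    (z ℤ.* (a ℤ.* b) ℤ.+ (y ℤ.* (a ℤ.* c) ℤ.+ (x ℤ.* (b ℤ.* c) ℤ.+ (1ℤ ℤ.* (ℤ.- (a ℤ.* b ℤ.* c)) ℤ.+ 0ℤ)))))))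
    ≡ (x ℤ.- a) ℤ.* ((y ℤ.- b) ℤ.* (z ℤ.- c))
  expand = solve-∀

Meet : ∀ {n m} (ℓ : Colour → Fin n → Fin m) → Fin n → Fin n → Set
Meet ℓ x v = ∃ λ c → ℓ c x ≡ ℓ c v

-- A Helly-type property: `point x` acts as a functional on the vectors `poly v`, and it vanishes
-- there exactly when x and v meet. The list is fixed before x, so x can be chosen to suit it.
eight-suffice : ∀ {n m} (ℓ : Colour → Fin n → Fin m) →
  ∃ λ (bs : List (Fin n)) → length bs ≤ 8 ×
    (∀ x → All (Meet ℓ x) bs → ∀ v → Meet ℓ x v)
eight-suffice ℓ = bs , proj₁ (proj₂ span) , λ x meets v →
  zero⇒meet x v (proj₂ (proj₂ span) (point x) (All.map (λ {b} → meet⇒zero x b) meets) v)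
  where
  label : Colour → Fin _ → ℤ
  label c v = + toℕ (ℓ c v)

  point poly : Fin _ → Vec ℤ 8
  point x = monomials    (label red x) (label blue x) (label yellow x)
  poly v  = coefficients (label red v) (label blue v) (label yellow v)

  span = spanning-sublist 8 poly
  bs   = proj₁ span

  gap : Colour → Fin _ → Fin _ → ℤ
  gap c x v = label c x ℤ.- label c v

  point·poly : ∀ x v → point x · poly v ≡ gap red x v ℤ.* (gap blue x v ℤ.* gap yellow x v)
  point·poly x v = monomials·coefficients (label red x) (label blue x) (label yellow x)
                                          (label red v) (label blue v) (label yellow v)

  gap≡0⇒≡ : ∀ c x v → gap c x v ≡ 0ℤ → ℓ c x ≡ ℓ c v
  gap≡0⇒≡ c x v eq = toℕ-injective (ℤ.+-injective (ℤ.i-j≡0⇒i≡j (label c x) (label c v) eq))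

  zero⇒meet : ∀ x v → point x · poly v ≡ 0ℤ → Meet ℓ x v
  zero⇒meet x v eq with ℤ.i*j≡0⇒i≡0∨j≡0 (gap red x v) (trans (sym (point·poly x v)) eq)
  ... | inj₁ r≡0 = red , gap≡0⇒≡ red x v r≡0
  ... | inj₂ by≡0 with ℤ.i*j≡0⇒i≡0∨j≡0 (gap blue x v) by≡0
  ...   | inj₁ b≡0 = blue   , gap≡0⇒≡ blue   x v b≡0
  ...   | inj₂ y≡0 = yellow , gap≡0⇒≡ yellow x v y≡0

  ≡⇒gap≡0 : ∀ c x v → ℓ c x ≡ ℓ c v → gap c x v ≡ 0ℤ
  ≡⇒gap≡0 c x v eq = ℤ.i≡j⇒i-j≡0 (cong (λ k → + toℕ k) eq)

  meet⇒zero : ∀ x v → Meet ℓ x v → point x · poly v ≡ 0ℤ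
  meet⇒zero x v (c , eq) = trans (point·poly x v) (product≡0 c (≡⇒gap≡0 c x v eq))
    where
    product≡0 : ∀ c → gap c x v ≡ 0ℤ → gap red x v ℤ.* (gap blue x v ℤ.* gap yellow x v) ≡ 0ℤ
    product≡0 red    g≡0 = cong (ℤ._* (gap blue x v ℤ.* gap yellow x v)) g≡0
    product≡0 blue   g≡0 = trans (cong (λ g → gap red x v ℤ.* (g ℤ.* gap yellow x v)) g≡0)
                                 (ℤ.*-zeroʳ (gap red x v))
    product≡0 yellow g≡0 = trans (cong (λ g → gap red x v ℤ.* (gap blue x v ℤ.* g)) g≡0)
                          (trans (cong (gap red x v ℤ.*_) (ℤ.*-zeroʳ (gap blue x v)))
                                 (ℤ.*-zeroʳ (gap red x v)))

-- Labelling the classes of an equivalence relation on a finite set.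

merge : ∀ {m} → Fin m → Fin m → Fin m → Fin m
merge a b c with c ≟ a
... | yes _ = b
... | no  _ = c

merge-source : ∀ {m} (a b : Fin m) → merge a b a ≡ b
merge-source a b with a ≟ a
... | yes _  = refl
... | no a≢a = contradiction refl a≢a

merge-target : ∀ {m} (a b : Fin m) → merge a b b ≡ b
merge-target a b with b ≟ a
... | yes _ = refl
... | no  _ = refl

-- Gives soundness of a merge: two elements that newly receive a common label come one from each of
-- the two merged classes.
merge-kernel : ∀ {m} (a b c d : Fin m) → merge a b c ≡ merge a b d →
               c ≡ d ⊎ (c ≡ a × d ≡ b) ⊎ (c ≡ b × d ≡ a)
merge-kernel a b c d eq with c ≟ a | d ≟ a
... | yes c≡a | yes d≡a = inj₁ (trans c≡a (sym d≡a))
... | yes c≡a | no  _   = inj₂ (inj₁ (c≡a , sym eq))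
... | no  _   | yes d≡a = inj₂ (inj₂ (eq , d≡a))
... | no  _   | no  _   = inj₁ eq

module _ {n ℓ} {_≈_ : Rel (Fin n) ℓ} (≈-equiv : IsEquivalence _≈_) where
  private module ≈ = IsEquivalence ≈-equiv

  -- Starts with all labels distinct and merges the labels of the two ends of each listed pair.
  -- Every merge is justified by a pair in `_≈_`, so equal labels never leave a class.
  labelling : (es : List (Fin n × Fin n)) → All (uncurry _≈_) es →
    ∃ λ (l : Fin n → Fin n) → All (uncurry λ u v → l u ≡ l v) es × (∀ x y → l x ≡ l y → x ≈ y)
  labelling [] [] = id , [] , λ x y → ≈.reflexive
  labelling ((u , v) ∷ es) (u≈v ∷ es⊆≈) with labelling es es⊆≈
  ... | l , complete , sound =
    merge (l u) (l v) ∘ l ,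
    trans (merge-source (l u) (l v)) (sym (merge-target (l u) (l v))) ∷
      All.map (cong (merge (l u) (l v))) complete ,
    sound′
    where
    sound′ : ∀ x y → merge (l u) (l v) (l x) ≡ merge (l u) (l v) (l y) → x ≈ y
    sound′ x y eq with merge-kernel (l u) (l v) (l x) (l y) eq
    ... | inj₁ x~y = sound x y x~y
    ... | inj₂ (inj₁ (x~u , y~v)) = ≈.trans (sound x u x~u) (≈.trans u≈v (sound v y (sym y~v)))
    ... | inj₂ (inj₂ (x~v , y~u)) = ≈.trans (sound x v x~v) (≈.trans (≈.sym u≈v) (sound u y (sym y~u)))

-- Monochromatic components and their labels.

_≟ᶜ_ : (c d : Colour) → Dec (c ≡ d)
red    ≟ᶜ red    = yes refl
red    ≟ᶜ blue   = no λ ()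
red    ≟ᶜ yellow = no λ ()
blue   ≟ᶜ red    = no λ ()
blue   ≟ᶜ blue   = yes refl
blue   ≟ᶜ yellow = no λ ()
yellow ≟ᶜ red    = no λ ()
yellow ≟ᶜ blue   = no λ ()
yellow ≟ᶜ yellow = yes refl

module _ {n} {G : Graph n} (χ : EdgeColouring G) (c : Colour) where

  ColEdge? : ∀ u v → Dec (ColEdge χ c u v)
  ColEdge? u v = T? (adj G u v) ×-dec (colour χ u v ≟ᶜ c)

  ColEdge-sym : ∀ {u v} → ColEdge χ c u v → ColEdge χ c v u
  ColEdge-sym {u} {v} (uv , eq) = subst T (symm G u v) uv , trans (sym (colSymm χ u v uv)) eq

  Reach-trans : ∀ {u v w} → Reach χ c u v → Reach χ c v w → Reach χ c u w
  Reach-trans p here       = p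
  Reach-trans p (step q e) = step (Reach-trans p q) e

  Reach-sym : ∀ {u v} → Reach χ c u v → Reach χ c v u
  Reach-sym here       = here
  Reach-sym (step p e) = Reach-trans (step here (ColEdge-sym e)) (Reach-sym p)

  Reach-isEquivalence : IsEquivalence (Reach χ c)
  Reach-isEquivalence = record { refl = here ; sym = Reach-sym ; trans = Reach-trans }

  -- Only edges are tested, never reachability, which enters as an equivalence containing them.
  -- Agreement of labels is recorded along single edges, which is the form used for a vertex
  -- adjacent to the chosen ones.
  componentLabelling : ∃ λ (l : Fin n → Fin n) →
    (∀ u v → ColEdge χ c u v → l u ≡ l v) × (∀ u v → l u ≡ l v → Reach χ c u v)
  componentLabelling with labelling Reach-isEquivalence edges (All.map (step here) (all-filter edge? pairs))
    where
    edge? = uncurry ColEdge?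
    pairs = cartesianProduct (allFin n) (allFin n)
    edges = filter edge? pairs
  ... | l , complete , sound =
    l ,
    (λ u v e → All.lookup complete (∈-filter⁺ (uncurry ColEdge?) (∈-cartesianProduct⁺ (∈-allFin u) (∈-allFin v)) e)) ,
    sound

-- Counting with filtered lists.

module _ {a p} {A : Set a} {P : Pred A p} (P? : Decidable P) where

  length-filter-complement : ∀ xs → length (filter P? xs) ℕ.+ length (filter (¬? ∘ P?) xs) ≡ length xs
  length-filter-complement [] = refl
  length-filter-complement (x ∷ xs) with P? x
  ... | yes _ = cong ℕ.suc (length-filter-complement xs)
  ... | no  _ = trans (ℕ.+-suc _ _) (cong ℕ.suc (length-filter-complement xs))

  -- The element `x` is kept by `Q?` and dropped by `P?`. This makes a closed neighbourhood larger
  -- than the degree.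
  length-filter-< : ∀ {q} {Q : Pred A q} (Q? : Decidable Q) → (∀ {x} → P x → Q x) →
    ∀ {x xs} → x ∈ xs → Q x → ¬ P x → length (filter P? xs) ℕ.< length (filter Q? xs)
  length-filter-< Q? P⊆Q {x} {_ ∷ xs} (Any.here refl) qx ¬px with P? x | Q? x
  ... | yes px | _      = contradiction px ¬px
  ... | no _   | no ¬qx = contradiction qx ¬qx
  ... | no _   | yes _  = ℕ.s≤s (length-mono-≤ (filter⁺ P? Q? (λ { refl → P⊆Q }) (⊆-refl {x = xs})))
  length-filter-< Q? P⊆Q {x} {y ∷ xs} (Any.there x∈xs) qx ¬px with P? y | Q? y
  ... | yes py | no ¬qy = contradiction (P⊆Q py) ¬qy
  ... | yes _  | yes _  = ℕ.s≤s (length-filter-< Q? P⊆Q x∈xs qx ¬px)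
  ... | no _   | yes _  = ℕ.m<n⇒m<1+n (length-filter-< Q? P⊆Q x∈xs qx ¬px)
  ... | no _   | no _   = length-filter-< Q? P⊆Q x∈xs qx ¬px

module _ {a b r} {A : Set a} {B : Set b} {_~_ : A → B → Set r} (_~?_ : ∀ u x → Dec (u ~ x)) where

  missed : A → List B → List B
  missed u = filter (¬? ∘ (u ~?_))

  -- The factor d lets the bound on the missed elements be a fraction m / d.
  common-element : ∀ d m us xs → (∀ u → d ℕ.* length (missed u xs) ≤ m) →
    length us ℕ.* m ℕ.< d ℕ.* length xs → ∃ λ x → x ∈ xs × All (_~ x) us
  common-element d m [] [] _ 0<d*0 = contradiction (subst (0 ℕ.<_) (ℕ.*-zeroʳ d) 0<d*0) ℕ.n≮0
  common-element d m [] (x ∷ _) _ _ = x , Any.here refl , []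
  common-element d m (u ∷ us) xs few small with common-element d m us kept few′ small′
    where
    kept = filter (u ~?_) xs

    few′ : ∀ w → d ℕ.* length (missed w kept) ≤ m
    few′ w = ℕ.≤-trans
      (ℕ.*-monoʳ-≤ d (length-mono-≤ (filter⁺ (¬? ∘ (w ~?_)) (¬? ∘ (w ~?_)) (λ { refl → id }) (filter-⊆ (u ~?_) xs))))
      (few w)

    -- Passing to `kept` costs at most `m` on the right, while the removal of `u` frees exactly one
    -- `m` on the left.
    small′ : length us ℕ.* m ℕ.< d ℕ.* length kept
    small′ = ℕ.+-cancelˡ-< m _ _ (begin-strict
      m ℕ.+ length us ℕ.* m                               <⟨ small ⟩
      d ℕ.* length xs                                     ≡⟨ cong (d ℕ.*_) (length-filter-complement (u ~?_) xs) ⟨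
      d ℕ.* (length kept ℕ.+ length (missed u xs))        ≡⟨ ℕ.*-distribˡ-+ d (length kept) _ ⟩
      d ℕ.* length kept ℕ.+ d ℕ.* length (missed u xs)    ≤⟨ ℕ.+-monoʳ-≤ (d ℕ.* length kept) (few u) ⟩
      d ℕ.* length kept ℕ.+ m                             ≡⟨ ℕ.+-comm _ m ⟩
      m ℕ.+ d ℕ.* length kept                             ∎)
      where open ℕ.≤-Reasoning
  ... | x , x∈kept , us~x with ∈-filter⁻ (u ~?_) {xs = xs} x∈kept
  ...   | x∈xs , u~x = x , x∈xs , u~x ∷ us~x

-- Closed neighbourhoods under the degree condition.

module _ {n} (G : Graph n) where

  -- Including `u` itself gains one vertex over the degree, which turns the bound n into n - 8 and
  -- makes the final count strict.
  _≈_ : Fin n → Fin n → Set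
  u ≈ x = u ≡ x ⊎ T (adj G u x)

  _≈?_ : ∀ u x → Dec (u ≈ x)
  u ≈? x = (u ≟ x) ⊎-dec T? (adj G u x)

  -- At least 7n/8 + 1 vertices are close to `u`, so at most n/8 - 1 are missed. The chain gives
  -- `8 * k + 8 ≤ n`, so the truncated subtraction loses nothing.
  few-missed : ∀ u → 7 ℕ.* n ≤ 8 ℕ.* degree G u →
               8 ℕ.* length (missed _≈?_ u (allFin n)) ≤ n ℕ.∸ 8
  few-missed u large = ℕ.m+n≤o⇒m≤o∸n (8 ℕ.* k) (ℕ.+-cancelˡ-≤ (7 ℕ.* n) _ _ (begin
    7 ℕ.* n ℕ.+ (8 ℕ.* k ℕ.+ 8)              ≤⟨ ℕ.+-monoˡ-≤ (8 ℕ.* k ℕ.+ 8) large ⟩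
    8 ℕ.* degree G u ℕ.+ (8 ℕ.* k ℕ.+ 8)     ≡⟨ regroup (degree G u) k ⟩
    8 ℕ.* (ℕ.suc (degree G u) ℕ.+ k)         ≤⟨ ℕ.*-monoʳ-≤ 8 (ℕ.+-monoˡ-≤ k degree<close) ⟩
    8 ℕ.* (length close ℕ.+ k)               ≡⟨ cong (8 ℕ.*_) (length-filter-complement (u ≈?_) (allFin n)) ⟩
    8 ℕ.* length (allFin n)                  ≡⟨ cong (8 ℕ.*_) (length-tabulate {n = n} id) ⟩
    8 ℕ.* n                                  ≡⟨ ℕ.+-comm n (7 ℕ.* n) ⟩
    7 ℕ.* n ℕ.+ n                            ∎))
    where
    open ℕ.≤-Reasoning
    close = filter (u ≈?_) (allFin n)
    k     = length (missed _≈?_ u (allFin n))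

    degree<close : degree G u ℕ.< length close
    degree<close = length-filter-< (λ x → T? (adj G u x)) (u ≈?_) inj₂ (∈-allFin u) (inj₁ refl)
      (subst T (irrefl G u))

    regroup : ∀ d k → 8 ℕ.* d ℕ.+ (8 ℕ.* k ℕ.+ 8) ≡ 8 ℕ.* (ℕ.suc d ℕ.+ k)
    regroup = ℕ-Ring.solve-∀

-- Covering by the three components of one vertex.

theorem1p6 : (n : ℕ) (G : Graph n) →
    (∀ v → 7 * n ≤ 8 * degree G v) →
    (χ : EdgeColouring G) →
    CoveredByDistinctColourComponents χ
-- Without vertices there is no root to choose and nothing to cover.
theorem1p6 ℕ.zero      G large χ = (λ _ → nothing) , λ ()
theorem1p6 n@(ℕ.suc _) G large χ = (λ _ → just x) , λ v →
  let c , x~v = helly x (All.map (λ {b} → close⇒meet b) bs≈x) v in c , sound c x v x~v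
  where
  label    = λ c → proj₁ (componentLabelling χ c)
  complete = λ c → proj₁ (proj₂ (componentLabelling χ c))
  sound    = λ c → proj₂ (proj₂ (componentLabelling χ c))

  bs     = proj₁ (eight-suffice label)
  |bs|≤8 = proj₁ (proj₂ (eight-suffice label))
  helly  = proj₂ (proj₂ (eight-suffice label))

  small : length bs ℕ.* (n ℕ.∸ 8) ℕ.< 8 ℕ.* length (allFin n)
  small = begin-strict
    length bs ℕ.* (n ℕ.∸ 8)    ≤⟨ ℕ.*-monoˡ-≤ (n ℕ.∸ 8) |bs|≤8 ⟩
    -- Strict since n is positive: for n = 1 + m, `n ∸ 8` computes to `m ∸ 7`, which is at most m.
    8 ℕ.* (n ℕ.∸ 8)            <⟨ ℕ.*-monoʳ-< 8 (ℕ.s≤s (ℕ.m∸n≤m _ 7)) ⟩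
    8 ℕ.* n                    ≡⟨ cong (8 ℕ.*_) (length-tabulate {n = n} id) ⟨
    8 ℕ.* length (allFin n)    ∎
    where open ℕ.≤-Reasoning

  common = common-element (_≈?_ G) 8 (n ℕ.∸ 8) bs (allFin n) (λ u → few-missed G u (large u)) small
  x      = proj₁ common
  bs≈x   = proj₂ (proj₂ common)

  close⇒meet : ∀ b → _≈_ G b x → Meet label x b
  -- A vertex shares its component of every colour with itself; red is an arbitrary choice.
  close⇒meet b (inj₁ refl) = red , refl
  close⇒meet b (inj₂ bx)   = colour χ b x , sym (complete _ b x (bx , refl))
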